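{- Let $f,g:\{0,1\}^n\to\{0,1\}$ be Boolean functions. If $f$ is PN-equivalent to $g$, then $OSV(f)=OSV(g)$, $OSV^0(f)=OSV^0(g)$ and $OSV^1(f)=OSV^1(g)$. (Contrapositive: if $OSV(f)\neq OSV(g)$, or $OSV^0(f)\neq OSV^0(g)$, or $OSV^1(f)\neq OSV^1(g)$, then $f$ is not PN-equivalent to $g$.)
   Context: For a word $x=(x_1,\dots,x_n)\in\{0,1\}^n$ and an index $i$, $x^i$ denotes the word obtained from $x$ by changing (flipping) its $i$-th bit. The (local) sensitivity of $f$ on $x$ is $s(f,x)=|\{i\in\{1,\dots,n\}: f(x)\neq f(x^i)\}|$. The ordered sensitivity vector $OSV(f)$ is the vector $(s(f,x^{(1)}),\dots,s(f,x^{(N)}))$, where $x^{(1)},\dots,x^{(N)}$ lists all $N=2^n$ words of $\{0,1\}^n$ in an order such that $s(f,x^{(1)})\ge\cdots\ge s(f,x^{(N)})$; equivalently, it is the multiset of local sensitivities of $f$ over all words. The ordered 0-sensitivity vector $OSV^0(f)$ and the ordered 1-sensitivity vector $OSV^1(f)$ are defined in the same way, but listing only the words $x$ with $f(x)=0$, respectively $f(x)=1$. PN-equivalence: $f$ is PN-equivalent to $g$ if there exist a permutation $\pi$ of the $n$ coordinates (acting on words by permuting their bits) and, for each coordinate $j$, a choice of whether or not to negate it (written $(\neg)x_j$, the choice being independent of $x$), such that $f(\pi((\neg)x_1,(\neg)x_2,\dots,(\neg)x_n))=g(x_1,\dots,x_n)$ for all $x\in\{0,1\}^n$. -}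

module Defs where

open import Data.Bool using (Bool; true; false; not; _xor_)
open import Data.Bool.Properties using (_≟_)
open import Data.Fin using (Fin)
open import Data.Fin.Permutation using (Permutation′; _⟨$⟩ʳ_)
open import Data.List using (List; []; _∷_; map; filter; length; allFin; cartesianProductWith)
open import Data.List.Membership.Propositional using (_∈_)
open import Data.List.Membership.Propositional.Properties using (∈-cartesianProductWith⁺)
open import Data.List.Relation.Unary.All using ([]; _∷_)
open import Data.List.Relation.Unary.AllPairs using ([]; _∷_)
open import Data.List.Relation.Unary.Any using (here; there)
open import Data.List.Relation.Unary.Unique.Propositional using (Unique)
open import Data.List.Relation.Unary.Unique.Propositional.Properties using (cartesianProductWith⁺)
import Data.List.Sort as Sort
open import Data.Nat using (ℕ; zero; suc)
open import Data.Nat.Properties using (≤-decTotalOrder)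
open import Data.Product using (Σ-syntax; _,_)
open import Data.Vec using (Vec; []; _∷_; lookup; tabulate; updateAt; zipWith)
open import Data.Vec.Properties using (∷-injective)
open import Relation.Binary.Properties.DecTotalOrder ≤-decTotalOrder using (≥-decTotalOrder)
open import Relation.Binary.PropositionalEquality using (_≡_; refl)
open import Relation.Nullary.Decidable using (¬?)

private
  variable
    n : ℕ

Word : ℕ → Set
Word n = Vec Bool n

BooleanFunction : ℕ → Set
BooleanFunction n = Word n → Bool

flipBit : Word n → Fin n → Word n
flipBit x i = updateAt x i not

sensitivity : BooleanFunction n → Word n → ℕ
sensitivity {n} f x =
  length (filter (λ i → ¬? (f x ≟ f (flipBit x i))) (allFin n))

bits : List Bool
bits = false ∷ true ∷ []

allWords : ∀ n → List (Word n)
allWords zero    = [] ∷ []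
allWords (suc n) = cartesianProductWith _∷_ bits (allWords n)

allWords-complete : (x : Word n) → x ∈ allWords n
allWords-complete []      = here refl
allWords-complete (b ∷ x) =
  ∈-cartesianProductWith⁺ _∷_ (bits-complete b) (allWords-complete x)
  where
  bits-complete : (c : Bool) → c ∈ bits
  bits-complete false = here refl
  bits-complete true  = there (here refl)

allWords-unique : ∀ n → Unique (allWords n)
allWords-unique zero    = [] ∷ []
allWords-unique (suc n) =
  cartesianProductWith⁺ _∷_ ∷-injective bits-unique (allWords-unique n)
  where
  bits-unique : Unique bits
  bits-unique = ((λ ()) ∷ []) ∷ [] ∷ []

sortDescending : List ℕ → List ℕ
sortDescending = Sort.sort ≥-decTotalOrder

OSV : BooleanFunction n → List ℕ
OSV {n} f = sortDescending (map (sensitivity f) (allWords n))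

OSVᵇ : Bool → BooleanFunction n → List ℕ
OSVᵇ {n} b f =
  sortDescending (map (sensitivity f) (filter (λ x → f x ≟ b) (allWords n)))

OSV⁰ : BooleanFunction n → List ℕ
OSV⁰ = OSVᵇ false

OSV¹ : BooleanFunction n → List ℕ
OSV¹ = OSVᵇ true

-- The j-th bit of permuteBits π x is the π(j)-th bit of x.

permuteBits : Permutation′ n → Word n → Word n
permuteBits π x = tabulate (λ j → lookup x (π ⟨$⟩ʳ j))

-- Negates exactly the bits of x at the positions where c is true:
-- true xor b is not b, and false xor b is b.

negateBits : Word n → Word n → Word n
negateBits c x = zipWith _xor_ c x

PNEquivalent : BooleanFunction n → BooleanFunction n → Set
PNEquivalent {n} f g =
  Σ[ π ∈ Permutation′ n ] Σ[ c ∈ Word n ]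
    (∀ (x : Word n) → f (permuteBits π (negateBits c x)) ≡ g x)

{-# OPTIONS --safe #-}

-- A PN-equivalence is a bijection φ of the words with f ∘ φ = g, and it carries the
-- neighbours of x to the neighbours of φ x, permuting the flipped positions.  Hence
-- s(g, x) = s(f, φ x), and φ only reorders the list of all words.

module Submission where

open import Defs
open import Data.Bool using (false; true; not; _xor_)
open import Data.Bool.Properties using (_≟_; xor-same; xor-assoc; not-distribʳ-xor)
open import Data.Fin using (Fin; zero; suc)
import Data.Fin.Properties as Fin
open import Data.Fin.Permutation
  using (Permutation′; _⟨$⟩ʳ_; flip; inverseˡ; inverseʳ)
open import Data.List using (List; []; _∷_; map; filter; length; allFin)
open import Data.List.Membership.Propositional using (_∈_)
open import Data.List.Membership.Propositional.Properties
  using (∈-allFin; ∈-map⁺)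
open import Data.List.Membership.Propositional.Properties.WithK using (unique∧set⇒bag)
open import Data.List.Properties using (map-cong; map-∘; length-map; filter-≐)
open import Data.List.Relation.Binary.BagAndSetEquality using (∼bag⇒↭)
open import Data.List.Relation.Binary.Permutation.Propositional
  using (_↭_; ↭-sym; ↭-trans; ↭⇒↭ₛ; module PermutationReasoning)
open import Data.List.Relation.Binary.Permutation.Propositional.Properties
  using (filter-↭; ↭-length)
import Data.List.Relation.Binary.Permutation.Propositional.Properties as Perm
open import Data.List.Relation.Binary.Pointwise using (Pointwise-≡⇒≡)
open import Data.List.Relation.Unary.Sorted.TotalOrder.Properties using (↗↭↗⇒≋)
open import Data.List.Relation.Unary.Unique.Propositional using (Unique)
import Data.List.Relation.Unary.Unique.Propositional.Properties as Unique
import Data.List.Sort as Sort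
open import Data.Nat using (ℕ)
open import Data.Nat.Properties using (≤-decTotalOrder)
open import Data.Product using (_×_; _,_; proj₁; proj₂)
open import Data.Sum using (_⊎_; inj₁; inj₂)
open import Data.Vec using ([]; _∷_; lookup)
open import Data.Vec.Properties
  using (lookup∘tabulate; tabulate∘lookup; tabulate-cong; lookup∘updateAt; lookup∘updateAt′)
open import Function using (_∘_; _↔_; Injection; Inverse; mk↔ₛ′; mk⇔)
open import Function.Construct.Composition using (_↔-∘_)
open import Function.Properties.Inverse using (↔⇒↣)
open import Level using (Level)
open import Relation.Binary.Bundles using (DecTotalOrder)
open import Relation.Binary.Properties.DecTotalOrder ≤-decTotalOrder using (≥-decTotalOrder)
open import Relation.Binary.PropositionalEquality
  using (_≡_; _≢_; refl; sym; trans; cong; cong₂; subst; subst₂; module ≡-Reasoning)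
open import Relation.Nullary using (¬_; yes; no)
open import Relation.Nullary.Decidable using (¬?)
open import Relation.Unary using (Pred; Decidable)

private
  variable
    a b p : Level
    A : Set a
    B : Set b
    n : ℕ

-- Serves the reindexing along a bijection twice: `h` is the permutation of positions when
-- sensitivities are counted, and the bijection of words when words are selected by their value.
filter-map : {P : Pred B p} (P? : Decidable P) (h : A → B) (xs : List A) →
  filter P? (map h xs) ≡ map h (filter (P? ∘ h) xs)
filter-map P? h []       = refl
filter-map P? h (x ∷ xs) with P? (h x)
... | yes _ = cong (h x ∷_) (filter-map P? h xs)
... | no  _ = filter-map P? h xs

-- Injectivity keeps the mapped list free of repetitions, and surjectivity keeps it complete, as `x`
-- is the image of its preimage. For lists without repetitions, having the same elements already
-- means having the same multiplicities, hence being permutations of each other.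
map-bijection-↭ : (φ : A ↔ A) {xs : List A} → Unique xs → (∀ x → x ∈ xs) →
  map (Inverse.to φ) xs ↭ xs
map-bijection-↭ φ {xs} unique complete =
  ∼bag⇒↭ (unique∧set⇒bag (Unique.map⁺ (Injection.injective (↔⇒↣ φ)) unique) unique
    (λ {x} → mk⇔ (λ _ → complete x)
                 (λ _ → subst (_∈ map (Inverse.to φ) xs) (Inverse.strictlyInverseˡ φ x)
                          (∈-map⁺ (Inverse.to φ) (complete (Inverse.from φ x))))))

-- Two sorted lists that are permutations of each other agree entry by entry in a total order. This
-- reduces each equality of ordered vectors to a permutation of unsorted lists.
sortDescending-↭ : {xs ys : List ℕ} → xs ↭ ys → sortDescending xs ≡ sortDescending ys
sortDescending-↭ {xs} {ys} xs↭ys = Pointwise-≡⇒≡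
  (↗↭↗⇒≋ (DecTotalOrder.totalOrder ≥-decTotalOrder) (sort-↗ xs) (sort-↗ ys)
    (↭⇒↭ₛ (↭-trans (sort-↭ xs) (↭-trans xs↭ys (↭-sym (sort-↭ ys))))))
  where open Sort ≥-decTotalOrder

-- The action on words is contravariant: bit `k` of the left side is bit `ρ (π k)` of `x`. With `π`
-- and `ρ` both arbitrary, the two inverse laws come from one argument.
permuteBits-inverse : (π ρ : Permutation′ n) → (∀ k → ρ ⟨$⟩ʳ (π ⟨$⟩ʳ k) ≡ k) →
  (x : Word n) → permuteBits π (permuteBits ρ x) ≡ x
permuteBits-inverse π ρ ρπ≡id x = trans
  (tabulate-cong λ k → trans (lookup∘tabulate _ (π ⟨$⟩ʳ k)) (cong (lookup x) (ρπ≡id k)))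
  (tabulate∘lookup x)

permuteBits-↔ : Permutation′ n → Word n ↔ Word n
permuteBits-↔ π = mk↔ₛ′ (permuteBits π) (permuteBits (flip π))
  (permuteBits-inverse π (flip π) (λ _ → inverseˡ π))
  (permuteBits-inverse (flip π) π (λ _ → inverseʳ π))

negateBits-involutive : (c x : Word n) → negateBits c (negateBits c x) ≡ x
negateBits-involutive []       []       = refl
negateBits-involutive (c ∷ cs) (x ∷ xs) = cong₂ _∷_
  (trans (sym (xor-assoc c c x)) (cong (_xor x) (xor-same c)))
  (negateBits-involutive cs xs)

negateBits-↔ : Word n → Word n ↔ Word n
negateBits-↔ c = mk↔ₛ′ (negateBits c) (negateBits c)
  (negateBits-involutive c) (negateBits-involutive c)

-- Position `j` of the permuted word reads position `π j` of `x`, so it sees the flip; by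
-- injectivity of `π` no other position does.
permuteBits-flipBit : (π : Permutation′ n) (x : Word n) (j : Fin n) →
  permuteBits π (flipBit x (π ⟨$⟩ʳ j)) ≡ flipBit (permuteBits π x) j
permuteBits-flipBit π x j = trans (tabulate-cong bit) (tabulate∘lookup _)
  where
  bit : ∀ k → lookup (flipBit x (π ⟨$⟩ʳ j)) (π ⟨$⟩ʳ k) ≡ lookup (flipBit (permuteBits π x) j) k
  bit k with k Fin.≟ j
  ... | yes refl = trans (lookup∘updateAt (π ⟨$⟩ʳ k) x)
          (sym (trans (lookup∘updateAt k (permuteBits π x)) (cong not (lookup∘tabulate _ k))))
  ... | no k≢j = trans
          (lookup∘updateAt′ (π ⟨$⟩ʳ k) (π ⟨$⟩ʳ j) (k≢j ∘ Injection.injective (↔⇒↣ π)) x)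
          (sym (trans (lookup∘updateAt′ k j k≢j (permuteBits π x)) (lookup∘tabulate _ k)))

negateBits-flipBit : (c x : Word n) (i : Fin n) →
  negateBits c (flipBit x i) ≡ flipBit (negateBits c x) i
negateBits-flipBit (c ∷ cs) (x ∷ xs) zero    = cong (_∷ _) (sym (not-distribʳ-xor c x))
negateBits-flipBit (c ∷ cs) (x ∷ xs) (suc i) = cong (_ ∷_) (negateBits-flipBit cs xs i)

module _ {f g : BooleanFunction n} (π : Permutation′ n) (c : Word n)
         (f∘φ≗g : ∀ x → f (permuteBits π (negateBits c x)) ≡ g x) where

  private
    φ : Word n → Word n
    φ x = permuteBits π (negateBits c x)

  φ-flipBit : ∀ x j → φ (flipBit x (π ⟨$⟩ʳ j)) ≡ flipBit (φ x) j
  φ-flipBit x j = trans (cong (permuteBits π) (negateBits-flipBit c x (π ⟨$⟩ʳ j)))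
                        (permuteBits-flipBit π (negateBits c x) j)

  map-φ-allWords-↭ : map φ (allWords n) ↭ allWords n
  map-φ-allWords-↭ =
    map-bijection-↭ (permuteBits-↔ π ↔-∘ negateBits-↔ c) (allWords-unique n) allWords-complete

  -- Position `j` is sensitive for `f` at `φ x` exactly when `π j` is sensitive for `g` at `x`, so
  -- `π` matches the two sets of sensitive positions.
  sensitivity-φ : ∀ x → sensitivity f (φ x) ≡ sensitivity g x
  sensitivity-φ x = begin
    length (filter (λ j → ¬? (f (φ x) ≟ f (flipBit (φ x) j))) (allFin n))
      ≡⟨ cong length (filter-≐ _ (sensitive? ∘ (π ⟨$⟩ʳ_))
           ( (λ {j} → subst₂ _≢_ (f∘φ≗g x) (neighbour j))
           , (λ {j} → subst₂ _≢_ (sym (f∘φ≗g x)) (sym (neighbour j))))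
           (allFin n)) ⟩
    length (filter (sensitive? ∘ (π ⟨$⟩ʳ_)) (allFin n))
      -- Mapping by `π` leaves the count unchanged and lets `π` move inside the filter, where it
      -- merely reorders `allFin n`.
      ≡⟨ length-map (π ⟨$⟩ʳ_) (filter (sensitive? ∘ (π ⟨$⟩ʳ_)) (allFin n)) ⟨
    length (map (π ⟨$⟩ʳ_) (filter (sensitive? ∘ (π ⟨$⟩ʳ_)) (allFin n)))
      ≡⟨ cong length (filter-map sensitive? (π ⟨$⟩ʳ_) (allFin n)) ⟨
    length (filter sensitive? (map (π ⟨$⟩ʳ_) (allFin n)))
      ≡⟨ ↭-length (filter-↭ sensitive? (map-bijection-↭ π (Unique.allFin⁺ n) ∈-allFin)) ⟩
    length (filter sensitive? (allFin n))
      ∎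
    where
    open ≡-Reasoning
    sensitive? : Decidable (λ i → g x ≢ g (flipBit x i))
    sensitive? i = ¬? (g x ≟ g (flipBit x i))
    neighbour : ∀ j → f (flipBit (φ x) j) ≡ g (flipBit x (π ⟨$⟩ʳ j))
    neighbour j = trans (cong f (sym (φ-flipBit x j))) (f∘φ≗g (flipBit x (π ⟨$⟩ʳ j)))

  -- Stated for any list, since it is applied both to all words and to the words with a prescribed
  -- value.
  map-sensitivity-φ : ∀ ws → map (sensitivity f) (map φ ws) ≡ map (sensitivity g) ws
  map-sensitivity-φ ws = trans (sym (map-∘ ws)) (map-cong sensitivity-φ ws)

  OSV-invariant : OSV f ≡ OSV g
  OSV-invariant = sortDescending-↭ (begin
    map (sensitivity f) (allWords n)         ↭⟨ Perm.map⁺ _ map-φ-allWords-↭ ⟨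
    map (sensitivity f) (map φ (allWords n)) ≡⟨ map-sensitivity-φ (allWords n) ⟩
    map (sensitivity g) (allWords n)         ∎)
    where open PermutationReasoning

  OSVᵇ-invariant : ∀ b → OSVᵇ b f ≡ OSVᵇ b g
  OSVᵇ-invariant b = sortDescending-↭ (begin
    map (sensitivity f) (filter f≟b (allWords n))
      ↭⟨ Perm.map⁺ _ (filter-↭ f≟b map-φ-allWords-↭) ⟨
    map (sensitivity f) (filter f≟b (map φ (allWords n)))
      ≡⟨ cong (map (sensitivity f)) (filter-map f≟b φ (allWords n)) ⟩
    map (sensitivity f) (map φ (filter (f≟b ∘ φ) (allWords n)))
      ≡⟨ map-sensitivity-φ _ ⟩
    map (sensitivity g) (filter (f≟b ∘ φ) (allWords n))
      -- Since `f (φ x)` equals `g x`, the bijection respects the split of the words by value, which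
      -- is what separates this case from the unrestricted one.
      ≡⟨ cong (map (sensitivity g)) (filter-≐ (f≟b ∘ φ) (λ x → g x ≟ b)
           ((λ {x} → trans (sym (f∘φ≗g x))) , (λ {x} → trans (f∘φ≗g x))) (allWords n)) ⟩
    map (sensitivity g) (filter (λ x → g x ≟ b) (allWords n))
      ∎)
    where
    open PermutationReasoning
    f≟b : Decidable (λ x → f x ≡ b)
    f≟b x = f x ≟ b

mainTheorem2 : ∀ (n : ℕ) (f g : BooleanFunction n) →
    (PNEquivalent f g → OSV f ≡ OSV g × OSV⁰ f ≡ OSV⁰ g × OSV¹ f ≡ OSV¹ g)
    × (OSV f ≢ OSV g ⊎ OSV⁰ f ≢ OSV⁰ g ⊎ OSV¹ f ≢ OSV¹ g → ¬ PNEquivalent f g)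
mainTheorem2 n f g = invariant , distinguishes
  where
  invariant : PNEquivalent f g → OSV f ≡ OSV g × OSV⁰ f ≡ OSV⁰ g × OSV¹ f ≡ OSV¹ g
  invariant (π , c , eq) =
    OSV-invariant π c eq , OSVᵇ-invariant π c eq false , OSVᵇ-invariant π c eq true

  distinguishes : OSV f ≢ OSV g ⊎ OSV⁰ f ≢ OSV⁰ g ⊎ OSV¹ f ≢ OSV¹ g → ¬ PNEquivalent f g
  distinguishes (inj₁ OSV≢)         f∼g = OSV≢ (proj₁ (invariant f∼g))
  distinguishes (inj₂ (inj₁ OSV⁰≢)) f∼g = OSV⁰≢ (proj₁ (proj₂ (invariant f∼g)))
  distinguishes (inj₂ (inj₂ OSV¹≢)) f∼g = OSV¹≢ (proj₂ (proj₂ (invariant f∼g)))
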